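{- For every integer $r\ge 1$ there exists a graph $G$ of order $n=7r$ such that $\operatorname{th}_{\gamma_P}^{\times}(G)\cdot\operatorname{th}_{\gamma_P}^{\times}(\overline G)=24r=\frac{24n}{7}$. Consequently, if $M(n)$ denotes the maximum of $\operatorname{th}_{\gamma_P}^{\times}(G)\cdot\operatorname{th}_{\gamma_P}^{\times}(\overline G)$ over all graphs $G$ of order $n$, then $M(n)=\Theta(n)$.
   Context: Graphs are finite, simple, undirected, with nonempty vertex set; the order of $G$ is $|V(G)|$; $\overline G$ is the complement of $G$. Power domination: for $B\subseteq V(G)$ put $B^{[0]}=B$ and $B^{[1]}=N[B]$ (the vertices of $B$ and all their neighbors); for $i\ge1$, $B^{[i+1]}$ is $B^{[i]}$ together with every vertex $w\notin B^{[i]}$ that is the unique neighbor outside $B^{[i]}$ of some vertex $v\in B^{[i]}$. $\operatorname{pt}_{\gamma_P}(G;B)$ is the least $t$ with $B^{[t]}=V(G)$ ($\infty$ if none exists), and $\operatorname{pt}_{\gamma_P}(G,k)=\min_{|B|=k}\operatorname{pt}_{\gamma_P}(G;B)$. For $G$ of order $n$ the initial cost product throttling number is $\operatorname{th}_{\gamma_P}^{\times}(G)=\min_{1\le k\le n}k(1+\operatorname{pt}_{\gamma_P}(G,k))$. $f=\Theta(g)$ means there are positive constants $c,C,k$ with $c\,g(n)\le f(n)\le C\,g(n)$ for all $n\ge k$. -}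

module Defs where

open import Data.Fin using (Fin; _≟_)
open import Data.Fin.Subset as Subset using (Subset; ∣_∣)
open import Data.Integer using (+_)
open import Data.Nat using (ℕ; zero; suc; NonZero; _+_; _*_; _≤_)
open import Data.Product using (∃; ∃-syntax; Σ-syntax; _×_; _,_)
open import Data.Rational as ℚ using (ℚ; 0ℚ)
open import Function using (flip; _∘_)
open import Level using (0ℓ)
open import Relation.Binary using (Rel; Decidable; Symmetric; Irreflexive)
open import Relation.Binary.PropositionalEquality using (_≡_; _≢_; sym)
open import Relation.Nullary using (¬_; ¬?; _×-dec_)
open import Relation.Nullary.Construct.Add.Supremum using (_⁺; [_]; ⊤⁺)
open import Relation.Unary using (Pred; _∈_; _∉_; _∪_; Universal)
import Relation.Binary.Construct.Add.Supremum.NonStrict as AddSup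

IsLeast : ∀ {a p ℓ} {A : Set a} → Rel A ℓ → Pred A p → A → Set _
IsLeast _≼_ P m = m ∈ P × (∀ {x} → x ∈ P → m ≼ x)

IsGreatest : ∀ {a p ℓ} {A : Set a} → Rel A ℓ → Pred A p → A → Set _
IsGreatest _≼_ = IsLeast (flip _≼_)

ℕ∞ : Set
ℕ∞ = ℕ ⁺

open AddSup _≤_ public using () renaming (_≤⁺_ to _≤∞_)

record Graph (n : ℕ) : Set₁ where
  field
    nonempty : NonZero n
    Adj      : Rel (Fin n) 0ℓ
    adj?     : Decidable Adj
    symm     : Symmetric Adj
    irrefl   : Irreflexive _≡_ Adj

complement : ∀ {n} → Graph n → Graph n
complement G = record
  { nonempty = nonempty
  ; Adj      = λ u v → u ≢ v × ¬ Adj u v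
  ; adj?     = λ u v → ¬? (u ≟ v) ×-dec ¬? (adj? u v)
  ; symm     = λ { (u≢v , ¬uv) → u≢v ∘ sym , ¬uv ∘ symm }
  ; irrefl   = λ { u≡v (u≢v , _) → u≢v u≡v }
  }
  where open Graph G

module _ {n : ℕ} (G : Graph n) where
  open Graph G

  VertexSet : Set₁
  VertexSet = Pred (Fin n) 0ℓ

  ClosedNeighbourhood : VertexSet → VertexSet
  ClosedNeighbourhood S = S ∪ λ w → ∃[ v ] v ∈ S × Adj v w

  -- w is the unique neighbour of v outside S.
  UniqueOutsideNeighbour : VertexSet → Fin n → Fin n → Set
  UniqueOutsideNeighbour S v w =
    w ∉ S × Adj v w × (∀ x → x ∉ S → Adj v x → x ≡ w)

  ForcingStep : VertexSet → VertexSet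
  ForcingStep S = S ∪ λ w → ∃[ v ] v ∈ S × UniqueOutsideNeighbour S v w

  -- Observed B i is the set B^[i].
  Observed : Subset n → ℕ → VertexSet
  Observed B zero          = Subset._∈ B
  Observed B (suc zero)    = ClosedNeighbourhood (Observed B zero)
  Observed B (suc (suc i)) = ForcingStep (Observed B (suc i))

  ObservesAllAt : Subset n → Pred ℕ 0ℓ
  ObservesAllAt B t = Universal (Observed B t)

  -- "pt(G; B) = τ", as a relation; the value ⊤⁺ is ∞.
  HasPropagationTime : Subset n → ℕ∞ → Set
  HasPropagationTime B [ t ] = IsLeast _≤_ (ObservesAllAt B) t
  HasPropagationTime B ⊤⁺    = ¬ ∃ (ObservesAllAt B)

  -- "pt(G, k) = τ", the minimum being taken in ℕ ∪ {∞}.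
  HasPropagationTimeOfSize : ℕ → ℕ∞ → Set
  HasPropagationTimeOfSize k =
    IsLeast _≤∞_ λ τ → ∃[ B ] ∣ B ∣ ≡ k × HasPropagationTime B τ

  -- k (1 + τ); since only k ≥ 1 is used, k (1 + ∞) = ∞.
  cost : ℕ → ℕ∞ → ℕ∞
  cost k [ t ] = [ k * (1 + t) ]
  cost k ⊤⁺    = ⊤⁺

  -- "th(G) = c".  The minimum is always finite, because k = n has cost n.
  HasThrottlingNumber : ℕ → Set
  HasThrottlingNumber c = IsLeast _≤∞_
    (λ γ → ∃[ k ] ∃[ τ ]
       1 ≤ k × k ≤ n × HasPropagationTimeOfSize k τ × γ ≡ cost k τ)
    [ c ]

-- "th(G) · th(complement of G) = p"
HasThrottlingProduct : ∀ {n} → Graph n → ℕ → Set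
HasThrottlingProduct G p = ∃[ a ] ∃[ b ]
  HasThrottlingNumber G a × HasThrottlingNumber (complement G) b × p ≡ a * b

IsMaxThrottlingProduct : ℕ → ℕ → Set₁
IsMaxThrottlingProduct n =
  IsGreatest _≤_ λ p → Σ[ G ∈ Graph n ] HasThrottlingProduct G p

fromℕ : ℕ → ℚ
fromℕ m = + m ℚ./ 1

infix 4 _=Θ_

-- Rational constants c, C suffice: a positive real lower constant can be
-- decreased, and an upper one increased, to a positive rational.
_=Θ_ : (f g : ℕ → ℕ) → Set
f =Θ g = ∃[ c ] ∃[ C ] ∃[ k ]
  0ℚ ℚ.< c × 0ℚ ℚ.< C × 1 ≤ k ×
  (∀ n → k ≤ n →
     c ℚ.* fromℕ (g n) ℚ.≤ fromℕ (f n) × fromℕ (f n) ℚ.≤ C ℚ.* fromℕ (g n))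

{-# OPTIONS --safe #-}
module Submission where

open import Defs
open import Data.Bool using (true; false)
open import Data.Empty using (⊥)
open import Data.Fin as Fin using (Fin; zero; suc; toℕ; _↑ˡ_; _↑ʳ_; splitAt; combine; remQuot)
open import Data.Fin.Properties as Fin using (any?; all?)
open import Data.Fin.Subset as Subset using (Subset; ∣_∣; ⁅_⁆)
open import Data.Fin.Subset.Properties as Subset using (anySubset?)
open import Data.Integer as ℤ using (+_)
import Data.Integer.Properties as ℤ
open import Data.List as List using (List; []; _∷_; length; take; drop; allFin)
import Data.List.Properties as List
open import Data.List.Membership.Propositional as List using (find; lose)
open import Data.List.Membership.Propositional.Properties using (∈-allFin; ∈-++⁻)
open import Data.List.Relation.Unary.Any as Any using (Any; here; there)
open import Data.Nat using (ℕ; zero; suc; z≤n; s≤s; NonZero; _+_; _*_; _∸_; _%_; _≤_; _<_; _≤?_)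
import Data.Nat as ℕ
open import Data.Nat.DivMod using (m/n*n≤m; m≡m%n+[m/n]*n; m%n<n)
open import Data.Nat.Properties as ℕ hiding (_≟_; _≤?_; _<?_)
open import Data.Nat.Tactic.RingSolver using (solve-∀)
open import Data.Product using (∃; ∃-syntax; Σ-syntax; _×_; _,_; proj₁; proj₂; map₂)
open import Data.Rational as ℚ using (ℚ; 0ℚ; 1ℚ; _/_)
import Data.Rational.Properties as ℚ
import Data.Rational.Unnormalised as ℚᵘ
import Data.Rational.Unnormalised.Properties as ℚᵘ
open import Data.Sum using (_⊎_; inj₁; inj₂; [_,_]′)
open import Data.Sum.Relation.Binary.Pointwise
  using (Pointwise; inj₁; inj₂; drop-inj₁; drop-inj₂; ⊎-decidable; ⊎-symmetric; ⊎-irreflexive)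
open import Data.Vec as Vec using ([]; _∷_; tabulate)
open import Data.Vec.Properties using ([]=⇒lookup; lookup⇒[]=; lookup∘tabulate; lookup-++ˡ; lookup-++ʳ)
open import Function using (id; _∘_; _⇔_; mk⇔; Equivalence)
open import Relation.Binary.PropositionalEquality
open import Relation.Nullary using (¬_; Dec; yes; no; does; ¬?; _×-dec_; _⊎-dec_; _→-dec_; contradiction)
open import Relation.Nullary.Construct.Add.Supremum using ([_]; ⊤⁺)
open import Relation.Nullary.Decidable using (from-yes; decidable-stable; dec-true; map′)
open import Relation.Binary.Construct.Add.Supremum.NonStrict _≤_ using ([_]; _≤⊤⁺; [≤]-injective)
import Relation.Unary as U

-- The extremal graph is r (C₄ ∪ K₃).  Sets observing it have at least 7r, 3r, 2r vertices
-- at time 0, 1, ≥ 2 respectively, so th = 6r, attained by dominating sets of size 3r.  In its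
-- complement two vertices from different components dominate, while the twin neighbours in
-- C₄ and K₃ keep a single vertex from observing everything by time 2; so th = 4.
--
-- For M(n) = Θ(n) the edgeless graph gives M(n) ≥ n.  Conversely, th ≤ 2γ, and γ(co G) > k
-- means that any k vertices have a common neighbour in G, so that γ(G) ≤ ⌈n/k⌉; this gives
-- M(n) ≤ 16n.  M(n) itself is found by a search over all graphs of order n.

open Graph using (Adj; adj?; symm; irrefl; nonempty)

-- Extrema of decidable predicates on the naturals.

least : ∀ {p} {P : ℕ → Set p} → U.Decidable P → ∀ m → P m → ∃ (IsLeast _≤_ P)
least P? zero    p = zero , p , λ _ → z≤n
least {P = P} P? (suc m) p with P? zero
... | yes p₀ = zero , p₀ , λ _ → z≤n
... | no ¬p₀ with k , pk , k-min ← least (P? ∘ suc) m p = suc k , pk , min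
  where
  min : ∀ {x} → P x → suc k ≤ x
  min {zero}  p₀ = contradiction p₀ ¬p₀
  min {suc x} px = s≤s (k-min px)

-- The reflection `b ∸_` turns a maximum below `b` into a minimum. Since monus truncates, reflecting
-- twice is the identity only up to `b`, which is where `bounded` enters.
greatest : ∀ {p} {P : ℕ → Set p} → U.Decidable P → ∀ b → (∀ {x} → P x → x ≤ b) →
           ∃ P → ∃ (IsGreatest _≤_ P)
greatest {P = P} P? b bounded (m , pm) = b ∸ k , pk , λ {x} px → begin
  x            ≡⟨ m∸[m∸n]≡n (bounded px) ⟨
  b ∸ (b ∸ x)  ≤⟨ ∸-monoʳ-≤ b (k-min {b ∸ x} (reflect px)) ⟩
  b ∸ k        ∎
  where
  open ≤-Reasoning
  reflect : ∀ {x} → P x → P (b ∸ (b ∸ x))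
  reflect px = subst P (sym (m∸[m∸n]≡n (bounded px))) px
  reflected = least (P? ∘ (b ∸_)) (b ∸ m) (reflect pm)
  k = proj₁ reflected
  pk = proj₁ (proj₂ reflected)
  k-min : ∀ {x} → P (b ∸ x) → k ≤ x
  k-min = proj₂ (proj₂ reflected)

-- Cardinalities of finite subsets.

∣++∣ : ∀ {m n} (p : Subset m) (q : Subset n) → ∣ p Vec.++ q ∣ ≡ ∣ p ∣ + ∣ q ∣
∣++∣ []          q = refl
∣++∣ (true ∷ p)  q = cong suc (∣++∣ p q)
∣++∣ (false ∷ p) q = ∣++∣ p q

∣p∪q∣≤∣p∣+∣q∣ : ∀ {n} (p q : Subset n) → ∣ p Subset.∪ q ∣ ≤ ∣ p ∣ + ∣ q ∣
∣p∪q∣≤∣p∣+∣q∣ []          []          = z≤n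
∣p∪q∣≤∣p∣+∣q∣ (true ∷ p)  (true ∷ q)  =
  s≤s (≤-trans (∣p∪q∣≤∣p∣+∣q∣ p q) (+-monoʳ-≤ ∣ p ∣ (n≤1+n _)))
∣p∪q∣≤∣p∣+∣q∣ (true ∷ p)  (false ∷ q) = s≤s (∣p∪q∣≤∣p∣+∣q∣ p q)
∣p∪q∣≤∣p∣+∣q∣ (false ∷ p) (true ∷ q)  =
  ≤-trans (s≤s (∣p∪q∣≤∣p∣+∣q∣ p q)) (≤-reflexive (sym (+-suc ∣ p ∣ ∣ q ∣)))
∣p∪q∣≤∣p∣+∣q∣ (false ∷ p) (false ∷ q) = ∣p∪q∣≤∣p∣+∣q∣ p q

x∈p⇒1≤∣p∣ : ∀ {n} {p : Subset n} {x} → x Subset.∈ p → 1 ≤ ∣ p ∣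
x∈p⇒1≤∣p∣ x∈p = ≤-trans (s≤s z≤n) (Subset.x∈p⇒∣p-x∣<∣p∣ x∈p)

∣p∣<2⇒x≡y : ∀ {n} {p : Subset n} {x y} → x Subset.∈ p → y Subset.∈ p → ∣ p ∣ < 2 → x ≡ y
∣p∣<2⇒x≡y {x = x} {y} x∈p y∈p ∣p∣<2 = decidable-stable (x Fin.≟ y) λ x≢y →
  <⇒≱ ∣p∣<2 (≤-trans (s≤s (x∈p⇒1≤∣p∣ (Subset.x∈p∧x≢y⇒x∈p-y x∈p x≢y)))
                     (Subset.x∈p⇒∣p-x∣<∣p∣ y∈p))

full⇒n≤∣p∣ : ∀ {n} {p : Subset n} → (∀ x → x Subset.∈ p) → n ≤ ∣ p ∣
full⇒n≤∣p∣ {n} full = ≤-trans (≤-reflexive (sym (Subset.∣⊤∣≡n n))) (Subset.p⊆q⇒∣p∣≤∣q∣ {p = Subset.⊤} λ {x} _ → full x)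

-- The throttling number as a computable minimum.

module _ {n} (G : Graph n) where

  observed? : ∀ B t → U.Decidable (Observed G B t)
  observed? B zero          x = x Subset.∈? B
  observed? B (suc zero)    x =
    observed? B 0 x ⊎-dec any? λ v → observed? B 0 v ×-dec adj? G v x
  observed? B (suc (suc t)) x =
    observed? B (suc t) x ⊎-dec any? λ v → observed? B (suc t) v ×-dec
      ¬? (observed? B (suc t) x) ×-dec adj? G v x ×-dec
      all? λ y → ¬? (observed? B (suc t) y) →-dec adj? G v y →-dec y Fin.≟ x

  observed⇒nonempty : ∀ B t {x} → Observed G B t x → ∃ (Subset._∈ B)
  observed⇒nonempty B zero          x∈B                = _ , x∈B
  observed⇒nonempty B (suc zero)    (inj₁ x∈B)         = _ , x∈B
  observed⇒nonempty B (suc zero)    (inj₂ (v , v∈B , _)) = v , v∈B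
  observed⇒nonempty B (suc (suc t)) (inj₁ obs)         = observed⇒nonempty B (suc t) obs
  observed⇒nonempty B (suc (suc t)) (inj₂ (_ , obs , _)) = observed⇒nonempty B (suc t) obs

  -- c = k (1 + t) for some B with |B| = k ≥ 1 that observes G by time t,
  -- where t need not be the propagation time of B.
  Achieves : ℕ → Set
  Achieves c = ∃[ B ] ∃[ t ] 1 ≤ ∣ B ∣ × ObservesAllAt G B t × c ≡ ∣ B ∣ * (1 + t)

  -- The nested minima collapse into one. If some set of size `∣ B ∣` finished before time `t`,
  -- cancelling `∣ B ∣` would contradict minimality of `c`; so `t` is the propagation time both of
  -- `B` and of its size.
  least-achieved⇒throttling : ∀ {c} → IsLeast _≤_ Achieves c → HasThrottlingNumber G c
  least-achieved⇒throttling {c} ((B , t , 1≤∣B∣ , obs , refl) , c-min) =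
    (∣ B ∣ , [ t ] , 1≤∣B∣ , Subset.∣p∣≤n B , ((B , refl , obs , t-min B refl) , τ-min) , refl) , γ-min
    where
    t-min : ∀ B′ → ∣ B′ ∣ ≡ ∣ B ∣ → ∀ {t′} → ObservesAllAt G B′ t′ → t ≤ t′
    t-min B′ eq {t′} obs′ = ℕ.s≤s⁻¹ (*-cancelˡ-≤ ∣ B ∣ ⦃ ℕ.>-nonZero 1≤∣B∣ ⦄
      (c-min (B′ , t′ , subst (1 ≤_) (sym eq) 1≤∣B∣ , obs′ , cong (_* suc t′) (sym eq))))

    τ-min : ∀ {τ} → (∃[ B′ ] ∣ B′ ∣ ≡ ∣ B ∣ × HasPropagationTime G B′ τ) → [ t ] ≤∞ τ
    τ-min {[ t′ ]} (B′ , eq , obs′ , _) = [ t-min B′ eq obs′ ]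
    τ-min {⊤⁺}     _                    = [ t ] ≤⊤⁺

    γ-min : ∀ {γ} → (∃[ k ] ∃[ τ ] 1 ≤ k × k ≤ n × HasPropagationTimeOfSize G k τ × γ ≡ cost G k τ) →
            [ c ] ≤∞ γ
    γ-min (_ , [ t′ ] , 1≤k , _ , ((B′ , refl , obs′ , _) , _) , refl) =
      [ c-min (B′ , t′ , 1≤k , obs′ , refl) ]
    γ-min (_ , ⊤⁺ , _ , _ , _ , refl) = _ ≤⊤⁺

  achieves? : U.Decidable Achieves
  achieves? c = map′ forget bound (anySubset? λ B → anyUpTo? (λ t →
    1 ≤? ∣ B ∣ ×-dec all? (observed? B t) ×-dec c ℕ.≟ ∣ B ∣ * (1 + t)) c)
    where
    P : Subset n → ℕ → Set
    P B t = 1 ≤ ∣ B ∣ × ObservesAllAt G B t × c ≡ ∣ B ∣ * (1 + t)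
    forget : (∃[ B ] ∃[ t ] t < c × P B t) → Achieves c
    forget (B , t , _ , p) = B , t , p
    -- As `B` is nonempty, the cost is at least `1 + t`, so only times below `c` need to be
    -- searched.
    bound : Achieves c → ∃[ B ] ∃[ t ] t < c × P B t
    bound (B , t , p@(1≤∣B∣ , _ , refl)) =
      B , t , m≤n*m (1 + t) ∣ B ∣ ⦃ ℕ.>-nonZero 1≤∣B∣ ⦄ , p

  achieves-n : Achieves n
  achieves-n = Subset.⊤ , 0 , subst (1 ≤_) (sym (Subset.∣⊤∣≡n n)) (ℕ.>-nonZero⁻¹ n ⦃ nonempty G ⦄) ,
    (λ _ → Subset.∈⊤) , sym (trans (*-identityʳ _) (Subset.∣⊤∣≡n n))

  -- Abstract because conversion checking would otherwise run the search over all subsets.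
  abstract
    throttling : ℕ
    throttling = proj₁ (least achieves? n achieves-n)

    throttling-least : IsLeast _≤_ Achieves throttling
    throttling-least = proj₂ (least achieves? n achieves-n)

  throttling-correct : HasThrottlingNumber G throttling
  throttling-correct = least-achieved⇒throttling throttling-least

  throttling-unique : ∀ {c} → HasThrottlingNumber G c → c ≡ throttling
  throttling-unique (c∈ , c-min) =
    ≤-antisym ([≤]-injective (c-min (proj₁ throttling-correct)))
              ([≤]-injective (proj₂ throttling-correct c∈))

  throttling≤ : ∀ {c} → Achieves c → throttling ≤ c
  throttling≤ = proj₂ throttling-least

  throttling≤n : throttling ≤ n
  throttling≤n = throttling≤ achieves-n

  ≤throttling : ∀ {c} → (∀ B t → 1 ≤ ∣ B ∣ → ObservesAllAt G B t → c ≤ ∣ B ∣ * (1 + t)) → c ≤ throttling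
  ≤throttling {c} c≤cost with B , t , 1≤∣B∣ , obs , eq ← proj₁ throttling-least =
    subst (c ≤_) (sym eq) (c≤cost B t 1≤∣B∣ obs)

  1≤throttling : 1 ≤ throttling
  1≤throttling = ≤throttling λ B t 1≤∣B∣ _ → *-mono-≤ 1≤∣B∣ (s≤s (z≤n {t}))

throttlingProduct : ∀ {n} → Graph n → ℕ
throttlingProduct G = throttling G * throttling (complement G)

throttlingProduct-correct : ∀ {n} (G : Graph n) → HasThrottlingProduct G (throttlingProduct G)
throttlingProduct-correct G =
  _ , _ , throttling-correct G , throttling-correct (complement G) , refl

throttlingProduct-unique : ∀ {n} (G : Graph n) {p} → HasThrottlingProduct G p → p ≡ throttlingProduct G
throttlingProduct-unique G (_ , _ , a-th , b-th , refl) =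
  cong₂ _*_ (throttling-unique G a-th) (throttling-unique (complement G) b-th)

-- Power domination inside a union of components.

-- f identifies G with a union of connected components of H.
record IsComponentEmbedding {m n} (G : Graph m) (H : Graph n) (f : Fin m → Fin n) : Set where
  field
    adj⁺      : ∀ {x y} → Adj G x y → Adj H (f x) (f y)
    adj⁻      : ∀ {x y} → Adj H (f x) (f y) → Adj G x y
    injective : ∀ {x y} → f x ≡ f y → x ≡ y
    closed    : ∀ {x w} → Adj H (f x) w → ∃[ y ] w ≡ f y

  closedNeighbourhood⇔ : ∀ {S T} → (∀ x → S x ⇔ T (f x)) →
                         ∀ x → ClosedNeighbourhood G S x ⇔ ClosedNeighbourhood H T (f x)
  closedNeighbourhood⇔ {S} {T} S⇔T x = mk⇔ to from
    where
    to : ClosedNeighbourhood G S x → ClosedNeighbourhood H T (f x)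
    to (inj₁ x∈S)             = inj₁ (Equivalence.to (S⇔T x) x∈S)
    to (inj₂ (v , v∈S , v~x)) = inj₂ (f v , Equivalence.to (S⇔T v) v∈S , adj⁺ v~x)
    from : ClosedNeighbourhood H T (f x) → ClosedNeighbourhood G S x
    from (inj₁ x∈T) = inj₁ (Equivalence.from (S⇔T x) x∈T)
    -- The observing vertex is a neighbour of `f x`, so it lies in the image of `f` as well.
    from (inj₂ (_ , v∈T , v~x)) with v , refl ← closed (symm H v~x) =
      inj₂ (v , Equivalence.from (S⇔T v) v∈T , adj⁻ v~x)

  forcingStep⇔ : ∀ {S T} → (∀ x → S x ⇔ T (f x)) →
                 ∀ x → ForcingStep G S x ⇔ ForcingStep H T (f x)
  forcingStep⇔ {S} {T} S⇔T x = mk⇔ to from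
    where
    unique⁺ : ∀ {v} → (∀ y → ¬ S y → Adj G v y → y ≡ x) → ∀ y → ¬ T y → Adj H (f v) y → y ≡ f x
    unique⁺ unique y y∉T v~y with z , refl ← closed v~y =
      cong f (unique z (y∉T ∘ Equivalence.to (S⇔T z)) (adj⁻ v~y))
    to : ForcingStep G S x → ForcingStep H T (f x)
    to (inj₁ x∈S) = inj₁ (Equivalence.to (S⇔T x) x∈S)
    to (inj₂ (v , v∈S , x∉S , v~x , unique)) = inj₂
      ( f v , Equivalence.to (S⇔T v) v∈S , x∉S ∘ Equivalence.from (S⇔T x) , adj⁺ v~x , unique⁺ unique )
    from : ForcingStep H T (f x) → ForcingStep G S x
    from (inj₁ x∈T) = inj₁ (Equivalence.from (S⇔T x) x∈T)
    from (inj₂ (_ , v∈T , x∉T , v~x , unique)) with v , refl ← closed (symm H v~x) = inj₂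
      ( v , Equivalence.from (S⇔T v) v∈T , x∉T ∘ Equivalence.to (S⇔T x) , adj⁻ v~x
      , λ y y∉S v~y → injective (unique (f y) (y∉S ∘ Equivalence.from (S⇔T y)) (adj⁺ v~y)) )

  -- Neither the domination step nor a force crosses between components, so the process in `H`
  -- restricts to the process in `G`, whatever `C` contains outside the image.
  observed⇔ : ∀ {B C} → (∀ x → x Subset.∈ B ⇔ f x Subset.∈ C) →
              ∀ t x → Observed G B t x ⇔ Observed H C t (f x)
  observed⇔ B⇔C zero          = B⇔C
  observed⇔ B⇔C (suc zero)    = closedNeighbourhood⇔ B⇔C
  observed⇔ B⇔C (suc (suc t)) = forcingStep⇔ (observed⇔ B⇔C (suc t))

open IsComponentEmbedding using (observed⇔)

-- Invariance under equivalence of adjacency.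

infix 4 _≋_
-- A graph also carries a decision procedure and proofs, so propositional equality would be too
-- strict for comparing a graph with its decoded code.
_≋_ : ∀ {n} → Graph n → Graph n → Set
G ≋ H = ∀ {u v} → Adj G u v ⇔ Adj H u v

≋-sym : ∀ {n} {G H : Graph n} → G ≋ H → H ≋ G
≋-sym G≋H = mk⇔ (Equivalence.from G≋H) (Equivalence.to G≋H)

complement-cong : ∀ {n} {G H : Graph n} → G ≋ H → complement G ≋ complement H
complement-cong G≋H = mk⇔ (map₂ (_∘ Equivalence.from G≋H)) (map₂ (_∘ Equivalence.to G≋H))

achieves-cong : ∀ {n} {G H : Graph n} → G ≋ H → ∀ {c} → Achieves G c → Achieves H c
achieves-cong {G = G} {H} G≋H (B , t , 1≤∣B∣ , obs , eq) =
  B , t , 1≤∣B∣ , (λ x → Equivalence.to (observed⇔ embedding (λ _ → mk⇔ id id) t x) (obs x)) , eq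
  where
  -- With the same vertices and edges, the identity embeds `G` as all of `H`.
  embedding : IsComponentEmbedding G H id
  embedding = record
    { adj⁺ = Equivalence.to G≋H ; adj⁻ = Equivalence.from G≋H ; injective = id ; closed = λ _ → _ , refl }

throttling-cong : ∀ {n} {G H : Graph n} → G ≋ H → throttling G ≡ throttling H
throttling-cong {G = G} {H} G≋H = ≤-antisym
  (throttling≤ G (achieves-cong {G = H} {G} (≋-sym {G = G} {H} G≋H) (proj₁ (throttling-least H))))
  (throttling≤ H (achieves-cong {G = G} {H} G≋H (proj₁ (throttling-least G))))

throttlingProduct-cong : ∀ {n} {G H : Graph n} → G ≋ H → throttlingProduct G ≡ throttlingProduct H
throttlingProduct-cong {G = G} {H} G≋H = cong₂ _*_ (throttling-cong {G = G} {H} G≋H)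
  (throttling-cong {G = complement G} {complement H} (complement-cong {G = G} {H} G≋H))

-- Coding graphs by finite subsets.

-- Symmetrising the code and discarding its diagonal makes every subset a valid code, so that a
-- search over all subsets is a search over graphs.
graphOf : ∀ {n} → NonZero n → Subset (n * n) → Graph n
graphOf n≢0 s = record
  { nonempty = n≢0
  ; Adj      = λ u v → u ≢ v × (combine u v Subset.∈ s ⊎ combine v u Subset.∈ s)
  ; adj?     = λ u v → ¬? (u Fin.≟ v) ×-dec (combine u v Subset.∈? s ⊎-dec combine v u Subset.∈? s)
  ; symm     = λ { (u≢v , uv) → u≢v ∘ sym , [ inj₂ , inj₁ ]′ uv }
  ; irrefl   = λ { u≡v (u≢v , _) → u≢v u≡v }
  }

∈-tabulate⇔ : ∀ {n} {P : Fin n → Set} (P? : U.Decidable P) i → i Subset.∈ tabulate (does ∘ P?) ⇔ P i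
∈-tabulate⇔ {P = P} P? i = mk⇔ to from
  where
  lookup≡ = lookup∘tabulate (does ∘ P?) i
  true⇒ : does (P? i) ≡ true → P i
  true⇒ eq with yes p ← P? i = p
  to : i Subset.∈ tabulate (does ∘ P?) → P i
  to i∈ = true⇒ (trans (sym lookup≡) ([]=⇒lookup i∈))
  from : P i → i Subset.∈ tabulate (does ∘ P?)
  from p = lookup⇒[]= i _ (trans lookup≡ (dec-true (P? i) p))

codeOf : ∀ {n} → Graph n → Subset (n * n)
codeOf {n} G = tabulate λ i → does (adj? G (proj₁ (remQuot {n} n i)) (proj₂ (remQuot {n} n i)))

graphOf-codeOf : ∀ {n} (G : Graph n) → graphOf (nonempty G) (codeOf G) ≋ G
graphOf-codeOf {n} G {u} {v} = mk⇔ to from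
  where
  ∈⇔ : ∀ u v → combine u v Subset.∈ codeOf G ⇔ Adj G u v
  ∈⇔ u v = subst (λ (u′ , v′) → combine u v Subset.∈ codeOf G ⇔ Adj G u′ v′)
    (Fin.remQuot-combine {n} {n} u v)
    (∈-tabulate⇔ (λ i → adj? G (proj₁ (remQuot {n} n i)) (proj₂ (remQuot {n} n i))) (combine u v))
  to : Adj (graphOf (nonempty G) (codeOf G)) u v → Adj G u v
  to (_ , inj₁ uv) = Equivalence.to (∈⇔ u v) uv
  to (_ , inj₂ vu) = symm G (Equivalence.to (∈⇔ v u) vu)
  from : Adj G u v → Adj (graphOf (nonempty G) (codeOf G)) u v
  from uv = (λ u≡v → irrefl G u≡v uv) , inj₁ (Equivalence.from (∈⇔ u v) uv)

-- Domination and the linear upper bound.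

fromList : ∀ {n} → List (Fin n) → Subset n
fromList xs = Subset.⋃ (List.map ⁅_⁆ xs)

∣fromList∣≤length : ∀ {n} (xs : List (Fin n)) → ∣ fromList xs ∣ ≤ length xs
∣fromList∣≤length {n} [] = ≤-reflexive (Subset.∣⊥∣≡0 n)
∣fromList∣≤length (x ∷ xs) = ≤-trans (∣p∪q∣≤∣p∣+∣q∣ ⁅ x ⁆ (fromList xs))
  (+-mono-≤ (≤-reflexive (Subset.∣⁅x⁆∣≡1 x)) (∣fromList∣≤length xs))

∈-fromList : ∀ {n} {x : Fin n} {xs} → x List.∈ xs → x Subset.∈ fromList xs
∈-fromList {x = x}        (here refl)  = Subset.x∈p∪q⁺ (inj₁ (Subset.x∈⁅x⁆ x))
∈-fromList {xs = y ∷ ys} (there x∈ys) = Subset.x∈p∪q⁺ {p = ⁅ y ⁆} (inj₂ (∈-fromList x∈ys))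

-- Lists are convenient to cut into chunks; repeated entries are harmless, since the length still
-- bounds the size of the set.
Dominates : ∀ {n} → Graph n → List (Fin n) → Set
Dominates G xs = ∀ x → Any (λ y → y ≡ x ⊎ Adj G y x) xs

vertex : ∀ {n} → Graph n → Fin n
vertex {n} G = Fin.fromℕ< (ℕ.>-nonZero⁻¹ n ⦃ nonempty G ⦄)

-- A dominating set observes everything at time 1, hence the factor 2 = 1 + 1.
dominates⇒throttling≤ : ∀ {n} (G : Graph n) xs → Dominates G xs → throttling G ≤ length xs * 2
dominates⇒throttling≤ G xs dom = ≤-trans
  (throttling≤ G (fromList xs , 1 , x∈p⇒1≤∣p∣ (proj₂ nonempty-xs) , obs , refl))
  (*-monoˡ-≤ 2 (∣fromList∣≤length xs))
  where
  obs : ObservesAllAt G (fromList xs) 1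
  obs x with find (dom x)
  ... | y , y∈xs , inj₁ refl = inj₁ (∈-fromList y∈xs)
  ... | y , y∈xs , inj₂ y~x  = inj₂ (y , ∈-fromList y∈xs , y~x)
  nonempty-xs = observed⇒nonempty G (fromList xs) 1 (obs (vertex G))

-- So short a list cannot dominate the complement. A vertex it misses there differs from every entry
-- and is not joined to it in the complement, hence is joined to it in `G`.
short⇒common-neighbour : ∀ {n} (G : Graph n) xs → length xs * 2 < throttling (complement G) →
                         ∃[ v ] (∀ {x} → x List.∈ xs → Adj G v x)
short⇒common-neighbour {n} G xs short
  with v , ¬dom ← Fin.¬∀⟶∃¬ n _
         (λ x → Any.any? (λ y → y Fin.≟ x ⊎-dec adj? (complement G) y x) xs)
         (λ dom → <⇒≱ short (dominates⇒throttling≤ (complement G) xs dom))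
  = v , λ {x} x∈xs → symm G (decidable-stable (adj? G x v) λ ¬x~v →
      ¬dom (lose x∈xs (undominated x ¬x~v)))
  where
  undominated : ∀ {v} x → ¬ Adj G x v → x ≡ v ⊎ Adj (complement G) x v
  undominated {v} x ¬x~v with x Fin.≟ v
  ... | yes x≡v = inj₁ x≡v
  ... | no  x≢v = inj₂ (x≢v , ¬x~v)

-- One common neighbour is chosen for each of `q` successive chunks of at most `k` entries. Chunks
-- may be empty, so exactly `q` vertices are chosen.
neighbours-by-chunks : ∀ {n} (G : Graph n) k →
  (∀ xs → length xs ≤ k → ∃[ v ] (∀ {x} → x List.∈ xs → Adj G v x)) →
  ∀ q xs → length xs ≤ q * k →
  ∃[ ys ] length ys ≡ q × (∀ {x} → x List.∈ xs → Any (λ y → Adj G y x) ys)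
neighbours-by-chunks G k common zero    []  _  = [] , refl , λ ()
neighbours-by-chunks G k common (suc q) xs len
  with v , v~ ← common (take k xs) (≤-trans (≤-reflexive (List.length-take k xs)) (m⊓n≤m k _))
     | ys , refl , ys~ ← neighbours-by-chunks G k common q (drop k xs)
         (≤-trans (≤-reflexive (List.length-drop k xs)) (m≤n+o⇒m∸n≤o (length xs) k len))
  = v ∷ ys , refl , λ x∈xs →
      [ here ∘ v~ , there ∘ ys~ ]′ (∈-++⁻ (take k xs) (subst (_ List.∈_) (sym (List.take++drop≡id k xs)) x∈xs))

-- This `k` is ⌈b/2⌉ - 1, the largest number with 2k < b: strict enough to rule out domination by
-- `k` vertices, yet large enough to bound `b` from above.
halve : ∀ b → 1 ≤ b → ∃[ k ] k * 2 < b × b ≤ suc k * 2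
halve 1 _ = 0 , s≤s z≤n , s≤s z≤n
halve 2 _ = 0 , s≤s z≤n , ≤-refl
halve (suc (suc b@(suc _))) _ with k , lower , upper ← halve b (s≤s z≤n) =
  suc k , s≤s (s≤s lower) , s≤s (s≤s upper)

-- If th(co G) > 2k then no k vertices dominate co G, that is, any k vertices
-- have a common neighbour in G; hence about n/k vertices dominate G.
throttlingProduct≤ : ∀ {n} (G : Graph n) → throttlingProduct G ≤ 16 * n
throttlingProduct≤ {n} G with halve (throttling (complement G)) (1≤throttling (complement G))
-- Here the complement has throttling number at most 2, and the trivial bound `n` for `G` suffices.
... | zero , _ , upper = begin
  throttlingProduct G  ≤⟨ *-mono-≤ (throttling≤n G) upper ⟩
  n * 2                ≡⟨ *-comm n 2 ⟩
  2 * n                ≤⟨ *-monoˡ-≤ n {2} {16} (s≤s (s≤s z≤n)) ⟩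
  16 * n               ∎
  where open ≤-Reasoning
... | k@(suc k-1) , lower , upper = begin
  throttlingProduct G          ≤⟨ *-mono-≤ a≤ b≤ ⟩
  q * 2 * (k * 4)              ≡⟨ regroup (n ℕ./ k) k ⟩
  8 * (k + n ℕ./ k * k)          ≤⟨ *-monoʳ-≤ 8 (+-mono-≤ k≤n (m/n*n≤m n k)) ⟩
  8 * (n + n)                  ≡⟨ double n ⟩
  16 * n                       ∎
  where
  open ≤-Reasoning
  q : ℕ
  -- Enough chunks of size `k` to cover all `n` vertices; the extra `k` from rounding up is absorbed
  -- by `k≤n`.
  q = suc (n ℕ./ k)
  regroup : ∀ d k → suc d * 2 * (k * 4) ≡ 8 * (k + d * k)
  regroup = solve-∀
  double : ∀ n → 8 * (n + n) ≡ 16 * n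
  double = solve-∀
  k≤n : k ≤ n
  k≤n = ≤-trans (m≤m*n k 2) (≤-trans (<⇒≤ lower) (throttling≤n (complement G)))
  b≤ : throttling (complement G) ≤ k * 4
  -- In this case 1 ≤ k, so 2(k + 1) ≤ 4k.
  b≤ = ≤-trans upper (≤-trans (*-monoˡ-≤ 2 (+-monoˡ-≤ k {1} {k} (s≤s z≤n))) (≤-reflexive (eq k)))
    where
    eq : ∀ k → (k + k) * 2 ≡ k * 4
    eq = solve-∀
  n≤q*k : length (allFin n) ≤ q * k
  n≤q*k = begin
    length (allFin n)     ≡⟨ List.length-tabulate id ⟩
    n                     ≡⟨ m≡m%n+[m/n]*n n k ⟩
    n % k + n ℕ./ k * k     ≤⟨ +-monoˡ-≤ (n ℕ./ k * k) (<⇒≤ (m%n<n n k)) ⟩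
    q * k                 ∎
  chunks = neighbours-by-chunks G k
    (λ xs len → short⇒common-neighbour G xs (≤-trans (s≤s (*-monoˡ-≤ 2 len)) lower)) q (allFin n) n≤q*k
  a≤ : throttling G ≤ q * 2
  a≤ with ys , len , ys~ ← chunks =
    subst (λ l → throttling G ≤ l * 2) len
      (dominates⇒throttling≤ G ys (λ x → Any.map inj₂ (ys~ (∈-allFin x))))

-- Existence of the maximum product.

-- Every graph agrees with a coded one up to `≋`, which preserves the product, so the codes realise
-- all values; the bound 16n makes `greatest` applicable.
maxThrottlingProduct : ∀ n → NonZero n → ∃ (IsMaxThrottlingProduct n)
maxThrottlingProduct n n≢0 = m , attained , maximal
  where
  P : ℕ → Set
  P p = ∃[ s ] p ≡ throttlingProduct (graphOf {n} n≢0 s)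
  code : ∀ {p} → (Σ[ G ∈ Graph n ] HasThrottlingProduct G p) → P p
  code (G , prod) = codeOf G , trans (throttlingProduct-unique G prod)
    (sym (throttlingProduct-cong {G = graphOf n≢0 (codeOf G)} {G} (graphOf-codeOf G)))
  searched : ∃ (IsGreatest _≤_ P)
  searched = greatest (λ p → anySubset? λ s → p ℕ.≟ throttlingProduct (graphOf n≢0 s)) (16 * n)
    (λ { (s , refl) → throttlingProduct≤ (graphOf n≢0 s) }) (_ , Subset.⊥ , refl)
  m = proj₁ searched
  attained : Σ[ G ∈ Graph n ] HasThrottlingProduct G m
  attained with s , eq ← proj₁ (proj₂ searched) =
    graphOf n≢0 s , subst (HasThrottlingProduct (graphOf n≢0 s)) (sym eq) (throttlingProduct-correct _)
  maximal : ∀ {p} → (Σ[ G ∈ Graph n ] HasThrottlingProduct G p) → p ≤ m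
  maximal G,prod = proj₂ (proj₂ searched) (code G,prod)

-- The edgeless graph and the linear lower bound.

edgeless : ∀ n → NonZero n → Graph n
edgeless n n≢0 = record
  { nonempty = n≢0
  ; Adj      = λ _ _ → ⊥
  ; adj?     = λ _ _ → no id
  ; symm     = id
  ; irrefl   = λ _ → id
  }

-- Without edges nothing is ever added, so an observing set must contain every vertex and costs at
-- least `n`.
edgeless-observed : ∀ {n} n≢0 {B} t {x} → Observed (edgeless n n≢0) B t x → x Subset.∈ B
edgeless-observed n≢0 zero          x∈B         = x∈B
edgeless-observed n≢0 (suc zero)    (inj₁ x∈B)  = x∈B
edgeless-observed n≢0 (suc (suc t)) (inj₁ obs)  = edgeless-observed n≢0 (suc t) obs
edgeless-observed n≢0 (suc (suc t)) (inj₂ (_ , _ , _ , () , _))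

n≤throttlingProduct-edgeless : ∀ n n≢0 → n ≤ throttlingProduct (edgeless n n≢0)
n≤throttlingProduct-edgeless n n≢0 = begin
  n                                   ≤⟨ ≤throttling (edgeless n n≢0) n≤cost ⟩
  throttling (edgeless n n≢0)         ≤⟨ m≤m*n _ _ ⦃ ℕ.>-nonZero (1≤throttling (complement (edgeless n n≢0))) ⦄ ⟩
  throttlingProduct (edgeless n n≢0)  ∎
  where
  open ≤-Reasoning
  n≤cost : ∀ B t → 1 ≤ ∣ B ∣ → ObservesAllAt (edgeless n n≢0) B t → n ≤ ∣ B ∣ * (1 + t)
  n≤cost B t _ obs = ≤-trans (full⇒n≤∣p∣ (edgeless-observed n≢0 t ∘ obs)) (m≤m*n ∣ B ∣ (suc t))

-- Disjoint unions of graphs.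

↑-elim : ∀ {m n} (P : Fin (m + n) → Set) → (∀ x → P (x ↑ˡ n)) → (∀ y → P (m ↑ʳ y)) → ∀ w → P w
↑-elim {m} {n} P left right w = subst P (Fin.join-splitAt m n w) (join (splitAt m w))
  where
  join : ∀ s → P (Fin.join m n s)
  join (inj₁ x) = left x
  join (inj₂ y) = right y

infixr 5 _⊕_
_⊕_ : ∀ {m n} → Graph m → Graph n → Graph (m + n)
_⊕_ {m} {n} G H = record
  { nonempty = ℕ.>-nonZero (≤-trans (ℕ.>-nonZero⁻¹ m ⦃ nonempty G ⦄) (m≤m+n m n))
  ; Adj      = λ u v → Pointwise (Adj G) (Adj H) (splitAt m u) (splitAt m v)
  ; adj?     = λ u v → ⊎-decidable (adj? G) (adj? H) (splitAt m u) (splitAt m v)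
  ; symm     = ⊎-symmetric (symm G) (symm H)
  ; irrefl   = λ { {u} refl → ⊎-irreflexive (irrefl G) (irrefl H) (pointwise-refl (splitAt m u)) }
  }
  where
  pointwise-refl : ∀ s → Pointwise _≡_ _≡_ s s
  pointwise-refl (inj₁ _) = inj₁ refl
  pointwise-refl (inj₂ _) = inj₂ refl

module _ {m n} (G : Graph m) (H : Graph n) where

  ↑ˡ-adj⁺ : ∀ {x y} → Adj G x y → Adj (G ⊕ H) (x ↑ˡ n) (y ↑ˡ n)
  ↑ˡ-adj⁺ {x} {y} x~y rewrite Fin.splitAt-↑ˡ m x n | Fin.splitAt-↑ˡ m y n = inj₁ x~y

  ↑ʳ-adj⁺ : ∀ {x y} → Adj H x y → Adj (G ⊕ H) (m ↑ʳ x) (m ↑ʳ y)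
  ↑ʳ-adj⁺ {x} {y} x~y rewrite Fin.splitAt-↑ʳ m n x | Fin.splitAt-↑ʳ m n y = inj₂ x~y

  ↑ˡ-adj⁻ : ∀ {x y} → Adj (G ⊕ H) (x ↑ˡ n) (y ↑ˡ n) → Adj G x y
  ↑ˡ-adj⁻ {x} {y} x~y rewrite Fin.splitAt-↑ˡ m x n | Fin.splitAt-↑ˡ m y n = drop-inj₁ x~y

  ↑ʳ-adj⁻ : ∀ {x y} → Adj (G ⊕ H) (m ↑ʳ x) (m ↑ʳ y) → Adj H x y
  ↑ʳ-adj⁻ {x} {y} x~y rewrite Fin.splitAt-↑ʳ m n x | Fin.splitAt-↑ʳ m n y = drop-inj₂ x~y

  ↑ˡ≁↑ʳ : ∀ {x y} → ¬ Adj (G ⊕ H) (x ↑ˡ n) (m ↑ʳ y)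
  ↑ˡ≁↑ʳ {x} {y} x~y rewrite Fin.splitAt-↑ˡ m x n | Fin.splitAt-↑ʳ m n y with () ← x~y

  ↑ʳ≁↑ˡ : ∀ {x y} → ¬ Adj (G ⊕ H) (m ↑ʳ y) (x ↑ˡ n)
  ↑ʳ≁↑ˡ y~x = ↑ˡ≁↑ʳ (symm (G ⊕ H) y~x)

  ↑ˡ-embedding : IsComponentEmbedding G (G ⊕ H) (_↑ˡ n)
  ↑ˡ-embedding = record
    { adj⁺      = ↑ˡ-adj⁺
    ; adj⁻      = ↑ˡ-adj⁻
    ; injective = Fin.↑ˡ-injective n _ _
    ; closed    = λ {x} {w} → ↑-elim (λ w → Adj (G ⊕ H) (x ↑ˡ n) w → ∃[ y ] w ≡ y ↑ˡ n)
        (λ y _ → y , refl) (λ y x~y → contradiction x~y ↑ˡ≁↑ʳ) w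
    }

  ↑ʳ-embedding : IsComponentEmbedding H (G ⊕ H) (m ↑ʳ_)
  ↑ʳ-embedding = record
    { adj⁺      = ↑ʳ-adj⁺
    ; adj⁻      = ↑ʳ-adj⁻
    ; injective = Fin.↑ʳ-injective m _ _
    ; closed    = λ {x} {w} → ↑-elim (λ w → Adj (G ⊕ H) (m ↑ʳ x) w → ∃[ y ] w ≡ m ↑ʳ y)
        (λ y x~y → contradiction x~y ↑ʳ≁↑ˡ) (λ y _ → y , refl) w
    }

∈⇔lookup : ∀ {m n} {B : Subset m} {C : Subset n} {x y} → Vec.lookup C y ≡ Vec.lookup B x →
           x Subset.∈ B ⇔ y Subset.∈ C
∈⇔lookup {B = B} {C} {x} {y} eq = mk⇔
  (λ x∈B → lookup⇒[]= y C (trans eq ([]=⇒lookup x∈B)))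
  (λ y∈C → lookup⇒[]= x B (trans (sym eq) ([]=⇒lookup y∈C)))

module _ {m n} (G : Graph m) (H : Graph n) (B : Subset m) (C : Subset n) (t : ℕ) where

  observed-↑ˡ⇔ : ∀ x → Observed G B t x ⇔ Observed (G ⊕ H) (B Vec.++ C) t (x ↑ˡ n)
  observed-↑ˡ⇔ = observed⇔ (↑ˡ-embedding G H) (λ x → ∈⇔lookup (lookup-++ˡ B C x)) t

  observed-↑ʳ⇔ : ∀ y → Observed H C t y ⇔ Observed (G ⊕ H) (B Vec.++ C) t (m ↑ʳ y)
  observed-↑ʳ⇔ = observed⇔ (↑ʳ-embedding G H) (λ y → ∈⇔lookup (lookup-++ʳ B C y)) t

-- Sizes of observing sets at a fixed time.

-- The time is fixed because such bounds add over disjoint unions, whereas throttling numbers need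
-- not: different components may prefer different times.
Requires : ∀ {n} → Graph n → ℕ → ℕ → Set
Requires G t k = ∀ B → ObservesAllAt G B t → k ≤ ∣ B ∣

Suffices : ∀ {n} → Graph n → ℕ → ℕ → Set
Suffices G t k = ∃[ B ] ∣ B ∣ ≡ k × ObservesAllAt G B t

requires-⊕ : ∀ {m n} (G : Graph m) (H : Graph n) t {k l} →
             Requires G t k → Requires H t l → Requires (G ⊕ H) t (k + l)
requires-⊕ {m} {n} G H t G-req H-req B∪C obs with B , C , refl ← Vec.splitAt m B∪C =
  subst (_ ≤_) (sym (∣++∣ B C)) (+-mono-≤
    (G-req B λ x → Equivalence.from (observed-↑ˡ⇔ G H B C t x) (obs (x ↑ˡ n)))
    (H-req C λ y → Equivalence.from (observed-↑ʳ⇔ G H B C t y) (obs (m ↑ʳ y))))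

suffices-⊕ : ∀ {m n} (G : Graph m) (H : Graph n) t {k l} →
             Suffices G t k → Suffices H t l → Suffices (G ⊕ H) t (k + l)
suffices-⊕ {m} {n} G H t (B , refl , B-obs) (C , refl , C-obs) =
  B Vec.++ C , ∣++∣ B C , ↑-elim {m} {n} _
    (λ x → Equivalence.to (observed-↑ˡ⇔ G H B C t x) (B-obs x))
    (λ y → Equivalence.to (observed-↑ʳ⇔ G H B C t y) (C-obs y))

suffices⇒throttling≤ : ∀ {n} (G : Graph n) t {k} → 1 ≤ k → Suffices G t k → throttling G ≤ k * (1 + t)
suffices⇒throttling≤ G t 1≤k (B , refl , obs) = throttling≤ G (B , t , 1≤k , obs , refl)

requires-at-0 : ∀ {n} (G : Graph n) → Requires G 0 n
requires-at-0 G B full = full⇒n≤∣p∣ full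

requires-1 : ∀ {n} (G : Graph n) t → Requires G t 1
requires-1 G t B obs = x∈p⇒1≤∣p∣ (proj₂ (observed⇒nonempty G B t (obs (vertex G))))

NoUniversalVertex : ∀ {n} → Graph n → Set
NoUniversalVertex G = ∀ v → ∃[ x ] x ≢ v × ¬ Adj G v x

-- A nonempty set with fewer than two elements is some singleton {v}, which leaves a vertex not
-- adjacent to `v` unobserved at time 1.
requires-2 : ∀ {n} (G : Graph n) → NoUniversalVertex G → Requires G 1 2
requires-2 G far B obs = ≮⇒≥ λ ∣B∣<2 →
  let v , v∈B = observed⇒nonempty G B 1 (obs (vertex G))
      x , x≢v , v≁x = far v
  in case (λ u∈B → ∣p∣<2⇒x≡y u∈B v∈B ∣B∣<2) x≢v v≁x (obs x)
  where
  case : ∀ {v x} → (∀ {u} → u Subset.∈ B → u ≡ v) → x ≢ v → ¬ Adj G v x → ¬ Observed G B 1 x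
  case ≡v x≢v v≁x (inj₁ x∈B)             = x≢v (≡v x∈B)
  case ≡v x≢v v≁x (inj₂ (u , u∈B , u~x)) with refl ← ≡v u∈B = v≁x u~x

-- Bounds for the complement.

-- Excluding u = a lets one condition cover both adjacent twins, as in `K₃`, and nonadjacent ones,
-- as in `C₄`.
TwinNeighbours : ∀ {n} → Graph n → Set
TwinNeighbours G = ∀ v → ∃[ a ] ∃[ b ]
  Adj G v a × Adj G v b × a ≢ b × (∀ u → u ≢ a → Adj G b u → Adj G a u)

-- Starting from v alone in co G, the G-neighbours a and b of v are unobserved at time 1;
-- since N(b) ⊆ N[a] in G, a vertex that might force a in co G also has b as a neighbour.
twinNeighbours⇒requires-2 : ∀ {n} (G : Graph n) → TwinNeighbours G → Requires (complement G) 2 2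
twinNeighbours⇒requires-2 G twins B obs = ≮⇒≥ λ ∣B∣<2 →
  let v , v∈B = observed⇒nonempty (complement G) B 2 (obs (vertex G))
      a , b , v~a , v~b , a≢b , N[b]⊆N[a] = twins v
      B≡v : ∀ {u} → u Subset.∈ B → u ≡ v
      B≡v u∈B = ∣p∣<2⇒x≡y u∈B v∈B ∣B∣<2
  in unforced a≢b N[b]⊆N[a] (unobserved B≡v v~a) (unobserved B≡v v~b) (obs a)
  where
  unobserved : ∀ {v x} → (∀ {u} → u Subset.∈ B → u ≡ v) → Adj G v x → ¬ Observed (complement G) B 1 x
  unobserved ≡v v~x (inj₁ x∈B) with refl ← ≡v x∈B = irrefl G refl v~x
  unobserved ≡v v~x (inj₂ (u , u∈B , _ , u≁x)) with refl ← ≡v u∈B = u≁x v~x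

  unforced : ∀ {a b} → a ≢ b → (∀ u → u ≢ a → Adj G b u → Adj G a u) →
             ¬ Observed (complement G) B 1 a → ¬ Observed (complement G) B 1 b →
             ¬ Observed (complement G) B 2 a
  unforced a≢b N[b]⊆N[a] a∉ b∉ (inj₁ a∈) = a∉ a∈
  unforced {a} {b} a≢b N[b]⊆N[a] a∉ b∉ (inj₂ (u , u∈ , _ , (u≢a , u≁a) , unique)) =
    a≢b (sym (unique b b∉ ((λ { refl → b∉ u∈ }) , λ u~b →
      u≁a (symm G (N[b]⊆N[a] u u≢a (symm G u~b))))))

-- Each vertex has a neighbour in `G`, which it loses in the complement.
twinNeighbours⇒noUniversalVertex : ∀ {n} (G : Graph n) → TwinNeighbours G → NoUniversalVertex (complement G)
twinNeighbours⇒noUniversalVertex G twins v with a , _ , v~a , _ ← twins v =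
  a , (λ a≡v → irrefl G (sym a≡v) v~a) , λ (_ , v≁a) → v≁a v~a

twinNeighbours-⊕ : ∀ {m n} (G : Graph m) (H : Graph n) →
                   TwinNeighbours G → TwinNeighbours H → TwinNeighbours (G ⊕ H)
twinNeighbours-⊕ {m} {n} G H G-twins H-twins = ↑-elim {m} {n} _ left right
  where
  left : ∀ v → ∃[ a ] ∃[ b ] Adj (G ⊕ H) (v ↑ˡ n) a × Adj (G ⊕ H) (v ↑ˡ n) b × a ≢ b ×
    (∀ u → u ≢ a → Adj (G ⊕ H) b u → Adj (G ⊕ H) a u)
  left v with a , b , v~a , v~b , a≢b , ⊆ ← G-twins v =
    a ↑ˡ n , b ↑ˡ n , ↑ˡ-adj⁺ G H v~a , ↑ˡ-adj⁺ G H v~b , a≢b ∘ Fin.↑ˡ-injective n _ _ ,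
    ↑-elim {m} {n} _
      (λ u u≢a b~u → ↑ˡ-adj⁺ G H (⊆ u (u≢a ∘ cong (_↑ˡ n)) (↑ˡ-adj⁻ G H b~u)))
      (λ u _ b~u → contradiction b~u (↑ˡ≁↑ʳ G H))
  right : ∀ v → ∃[ a ] ∃[ b ] Adj (G ⊕ H) (m ↑ʳ v) a × Adj (G ⊕ H) (m ↑ʳ v) b × a ≢ b ×
    (∀ u → u ≢ a → Adj (G ⊕ H) b u → Adj (G ⊕ H) a u)
  right v with a , b , v~a , v~b , a≢b , ⊆ ← H-twins v =
    m ↑ʳ a , m ↑ʳ b , ↑ʳ-adj⁺ G H v~a , ↑ʳ-adj⁺ G H v~b , a≢b ∘ Fin.↑ʳ-injective m _ _ ,
    ↑-elim {m} {n} _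
      (λ u _ b~u → contradiction b~u (↑ʳ≁↑ˡ G H))
      (λ u u≢a b~u → ↑ʳ-adj⁺ G H (⊆ u (u≢a ∘ cong (m ↑ʳ_)) (↑ʳ-adj⁻ G H b~u)))

NoCommonNeighbour : ∀ {n} → Graph n → Set
NoCommonNeighbour G = ∃[ u ] ∃[ v ] u ≢ v × (∀ x → ¬ (Adj G u x × Adj G v x))

noCommonNeighbour-⊕ : ∀ {m n} (G : Graph m) (H : Graph n) → NoCommonNeighbour (G ⊕ H)
noCommonNeighbour-⊕ {m} {n} G H = x ↑ˡ n , m ↑ʳ y , x≢y , ↑-elim {m} {n} _
  (λ _ (_ , y~w) → ↑ʳ≁↑ˡ G H y~w) (λ _ (x~w , _) → ↑ˡ≁↑ʳ G H x~w)
  where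
  x = vertex G
  y = vertex H
  x≢y : x ↑ˡ n ≢ m ↑ʳ y
  x≢y eq with () ← trans (sym (Fin.splitAt-↑ˡ m x n)) (trans (cong (splitAt m) eq) (Fin.splitAt-↑ʳ m n y))

-- Any other vertex is nonadjacent in `G` to `u` or to `v`, so these two dominate the complement, at
-- cost 2(1 + 1).
noCommonNeighbour⇒throttling-complement≤4 : ∀ {n} (G : Graph n) → NoCommonNeighbour G →
                                           throttling (complement G) ≤ 4
noCommonNeighbour⇒throttling-complement≤4 G (u , v , u≢v , disjoint) =
  dominates⇒throttling≤ (complement G) (u ∷ v ∷ []) dom
  where
  dom : Dominates (complement G) (u ∷ v ∷ [])
  dom x with u Fin.≟ x | v Fin.≟ x | adj? G u x
  ... | yes u≡x | _       | _       = here (inj₁ u≡x)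
  ... | no  _   | yes v≡x | _       = there (here (inj₁ v≡x))
  ... | no  u≢x | no  _   | no  u≁x = here (inj₂ (u≢x , u≁x))
  ... | no  _   | no  v≢x | yes u~x = there (here (inj₂ (v≢x , λ v~x → disjoint x (u~x , v~x))))

-- Time 0 needs all `n` vertices, times 1 and 2 need two vertices, and from time 3 on even a single
-- vertex costs 4.
twinNeighbours⇒4≤throttling-complement : ∀ {n} (G : Graph n) → 4 ≤ n → TwinNeighbours G →
                                        4 ≤ throttling (complement G)
twinNeighbours⇒4≤throttling-complement {n} G 4≤n twins = ≤throttling (complement G) 4≤cost
  where
  4≤cost : ∀ B t → 1 ≤ ∣ B ∣ → ObservesAllAt (complement G) B t → 4 ≤ ∣ B ∣ * (1 + t)
  4≤cost B 0 1≤∣B∣ obs = *-mono-≤ (≤-trans 4≤n (requires-at-0 (complement G) B obs)) (≤-refl {1})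
  4≤cost B 1 1≤∣B∣ obs =
    *-mono-≤ (requires-2 (complement G) (twinNeighbours⇒noUniversalVertex G twins) B obs) (≤-refl {2})
  4≤cost B 2 1≤∣B∣ obs = *-mono-≤ (twinNeighbours⇒requires-2 G twins B obs) (s≤s (s≤s (z≤n {1})))
  4≤cost B (suc (suc (suc t))) 1≤∣B∣ obs = *-mono-≤ 1≤∣B∣ (s≤s (s≤s (s≤s (s≤s (z≤n {t})))))

-- The extremal family.

-- The 4-cycle is encoded as the complete bipartite graph between even and odd indices.
C₄ : Graph 4
C₄ = record
  { nonempty = _
  ; Adj      = λ u v → toℕ u % 2 ≢ toℕ v % 2
  ; adj?     = λ u v → ¬? (toℕ u % 2 ℕ.≟ toℕ v % 2)
  ; symm     = λ u~v → u~v ∘ sym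
  ; irrefl   = λ { refl u~u → u~u refl }
  }

K₃ : Graph 3
K₃ = complement (edgeless 3 _)

twinNeighbours? : ∀ {n} (G : Graph n) → Dec (TwinNeighbours G)
twinNeighbours? G = all? λ v → any? λ a → any? λ b → adj? G v a ×-dec adj? G v b ×-dec ¬? (a Fin.≟ b) ×-dec
  all? λ u → ¬? (u Fin.≟ a) →-dec adj? G b u →-dec adj? G a u

twinNeighbours-C₄ : TwinNeighbours C₄
twinNeighbours-C₄ = from-yes (twinNeighbours? C₄)

twinNeighbours-K₃ : TwinNeighbours K₃
twinNeighbours-K₃ = from-yes (twinNeighbours? K₃)

requires-C₄ : Requires C₄ 1 2
requires-C₄ = requires-2 C₄ (from-yes (all? λ v → any? λ x → ¬? (x Fin.≟ v) ×-dec ¬? (adj? C₄ v x)))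

suffices-C₄ : Suffices C₄ 1 2
suffices-C₄ = B , refl , from-yes (all? (observed? C₄ B 1))
  -- One vertex of each parity: each dominates the opposite class.
  where B = fromList (zero ∷ suc zero ∷ [])

suffices-K₃ : Suffices K₃ 1 1
suffices-K₃ = ⁅ zero ⁆ , refl , λ
  { zero    → inj₁ (Subset.x∈⁅x⁆ zero)
  ; (suc _) → inj₂ (zero , Subset.x∈⁅x⁆ zero , (λ ()) , id)
  }

-- Graphs are nonempty, so the index is shifted: `copies r` has `suc r` copies, and its order is
-- `suc r * 7` by computation.
copies : ∀ r → Graph (7 + r * 7)
copies zero    = C₄ ⊕ K₃
copies (suc r) = (C₄ ⊕ K₃) ⊕ copies r

requires-copies : ∀ t {k} → Requires (C₄ ⊕ K₃) t k → ∀ r → Requires (copies r) t (suc r * k)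
requires-copies t {k} req zero    = subst (Requires (C₄ ⊕ K₃) t) (sym (*-identityˡ k)) req
requires-copies t {k} req (suc r) = requires-⊕ (C₄ ⊕ K₃) (copies r) t req (requires-copies t req r)

suffices-copies : ∀ r → Suffices (copies r) 1 (suc r * 3)
suffices-copies zero    = suffices-⊕ C₄ K₃ 1 suffices-C₄ suffices-K₃
suffices-copies (suc r) = suffices-⊕ (C₄ ⊕ K₃) (copies r) 1 (suffices-copies zero) (suffices-copies r)

-- Per copy the cost is at least 7·1 at time 0, 3·2 at time 1, and 2·3 from time 2 on, when each
-- component still needs a vertex. Dominating sets attain 3·2.
throttling-copies : ∀ r → throttling (copies r) ≡ suc r * 6
throttling-copies r = ≤-antisym upper (≤throttling (copies r) 6r≤cost)
  where
  open ≤-Reasoning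
  upper : throttling (copies r) ≤ suc r * 6
  upper = begin
    throttling (copies r)  ≤⟨ suffices⇒throttling≤ (copies r) 1 (s≤s z≤n) (suffices-copies r) ⟩
    suc r * 3 * 2          ≡⟨ *-assoc (suc r) 3 2 ⟩
    suc r * 6              ∎

  6r≤cost : ∀ B t → 1 ≤ ∣ B ∣ → ObservesAllAt (copies r) B t → suc r * 6 ≤ ∣ B ∣ * (1 + t)
  6r≤cost B 0 _ obs = begin
    suc r * 6       ≤⟨ *-monoʳ-≤ (suc r) (n≤1+n 6) ⟩
    suc r * 7       ≤⟨ requires-at-0 (copies r) B obs ⟩
    ∣ B ∣           ≡⟨ *-identityʳ _ ⟨
    ∣ B ∣ * 1       ∎
  6r≤cost B 1 _ obs = begin
    suc r * 6       ≡⟨ *-assoc (suc r) 3 2 ⟨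
    suc r * 3 * 2   ≤⟨ *-monoˡ-≤ 2 (requires-copies 1 (requires-⊕ C₄ K₃ 1 requires-C₄ (requires-1 K₃ 1)) r B obs) ⟩
    ∣ B ∣ * 2       ∎
  6r≤cost B t@(suc (suc t-2)) _ obs = begin
    suc r * 6       ≡⟨ *-assoc (suc r) 2 3 ⟨
    suc r * 2 * 3   ≤⟨ *-mono-≤ (requires-copies t (requires-⊕ C₄ K₃ t (requires-1 C₄ t) (requires-1 K₃ t)) r B obs)
                                (s≤s (s≤s (s≤s (z≤n {t-2})))) ⟩
    ∣ B ∣ * (1 + t) ∎

twinNeighbours-copies : ∀ r → TwinNeighbours (copies r)
twinNeighbours-copies zero    = twinNeighbours-⊕ C₄ K₃ twinNeighbours-C₄ twinNeighbours-K₃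
twinNeighbours-copies (suc r) = twinNeighbours-⊕ (C₄ ⊕ K₃) (copies r) (twinNeighbours-copies zero) (twinNeighbours-copies r)

noCommonNeighbour-copies : ∀ r → NoCommonNeighbour (copies r)
noCommonNeighbour-copies zero    = noCommonNeighbour-⊕ C₄ K₃
noCommonNeighbour-copies (suc r) = noCommonNeighbour-⊕ (C₄ ⊕ K₃) (copies r)

throttling-complement-copies : ∀ r → throttling (complement (copies r)) ≡ 4
throttling-complement-copies r = ≤-antisym
  (noCommonNeighbour⇒throttling-complement≤4 (copies r) (noCommonNeighbour-copies r))
  (twinNeighbours⇒4≤throttling-complement (copies r) (s≤s (s≤s (s≤s (s≤s z≤n)))) (twinNeighbours-copies r))

throttlingProduct-copies : ∀ r → HasThrottlingProduct (copies r) (24 * suc r)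
throttlingProduct-copies r = subst (HasThrottlingProduct (copies r)) eq (throttlingProduct-correct (copies r))
  where
  eq : throttlingProduct (copies r) ≡ 24 * suc r
  eq = trans (cong₂ _*_ (throttling-copies r) (throttling-complement-copies r))
             (trans (*-assoc (suc r) 6 4) (*-comm (suc r) 24))

-- Passage from naturals to rationals.

toℚᵘ-fromℕ : ∀ m → ℚ.toℚᵘ (fromℕ m) ℚᵘ.≃ ℚᵘ.mkℚᵘ (+ m) 0
toℚᵘ-fromℕ m = ℚ.toℚᵘ-fromℚᵘ (ℚᵘ.mkℚᵘ (+ m) 0)

fromℕ-mono-≤ : ∀ {m n} → m ≤ n → fromℕ m ℚ.≤ fromℕ n
fromℕ-mono-≤ {m} {n} m≤n = ℚ.toℚᵘ-cancel-≤ (begin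
  ℚ.toℚᵘ (fromℕ m)  ≃⟨ toℚᵘ-fromℕ m ⟩
  ℚᵘ.mkℚᵘ (+ m) 0   ≤⟨ ℚᵘ.*≤* (ℤ.*-monoʳ-≤-nonNeg (+ 1) (ℤ.+≤+ m≤n)) ⟩
  ℚᵘ.mkℚᵘ (+ n) 0   ≃⟨ toℚᵘ-fromℕ n ⟨
  ℚ.toℚᵘ (fromℕ n)  ∎)
  where open ℚᵘ.≤-Reasoning

fromℕ-homo-* : ∀ m n → fromℕ (m * n) ≡ fromℕ m ℚ.* fromℕ n
fromℕ-homo-* m n = ℚ.toℚᵘ-injective (begin
  ℚ.toℚᵘ (fromℕ (m * n))                    ≈⟨ toℚᵘ-fromℕ (m * n) ⟩
  ℚᵘ.mkℚᵘ (+ (m * n)) 0                     ≈⟨ ℚᵘ.*≡* (cong (ℤ._* + 1) (ℤ.pos-* m n)) ⟩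
  ℚᵘ.mkℚᵘ (+ m) 0 ℚᵘ.* ℚᵘ.mkℚᵘ (+ n) 0      ≈⟨ ℚᵘ.*-cong (toℚᵘ-fromℕ m) (toℚᵘ-fromℕ n) ⟨
  ℚ.toℚᵘ (fromℕ m) ℚᵘ.* ℚ.toℚᵘ (fromℕ n)    ≈⟨ ℚ.toℚᵘ-homo-* (fromℕ m) (fromℕ n) ⟨
  ℚ.toℚᵘ (fromℕ m ℚ.* fromℕ n)              ∎)
  where open import Relation.Binary.Reasoning.Setoid ℚᵘ.≃-setoid

24r≡24n/7 : ∀ r → fromℕ (24 * r) ≡ + (24 * (7 * r)) / 7
-- Cross-multiplying unnormalised fractions avoids reducing to lowest terms. `mkℚᵘ` stores the
-- denominator minus one, so 6 stands for 7.
24r≡24n/7 r = ℚ.fromℚᵘ-cong {ℚᵘ.mkℚᵘ (+ (24 * r)) 0} {ℚᵘ.mkℚᵘ (+ (24 * (7 * r))) 6} (ℚᵘ.*≡* (begin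
  + (24 * r) ℤ.* + 7        ≡⟨ ℤ.pos-* (24 * r) 7 ⟨
  + (24 * r * 7)            ≡⟨ cong +_ (eq r) ⟩
  + (24 * (7 * r))          ≡⟨ ℤ.*-identityʳ _ ⟨
  + (24 * (7 * r)) ℤ.* + 1  ∎))
  where
  open ≡-Reasoning
  eq : ∀ r → 24 * r * 7 ≡ 24 * (7 * r)
  eq = solve-∀

-- The extremal products and the order of growth.

corollary4p12 : (∀ r → 1 ≤ r →
    ∃[ n ] Σ[ G ∈ Graph n ] ∃[ p ]
    n ≡ 7 * r × HasThrottlingProduct G p ×
    p ≡ 24 * r × fromℕ p ≡ + (24 * n) / 7)
    ×
    (∃[ M ] (∀ n → 1 ≤ n → IsMaxThrottlingProduct n (M n)) × M =Θ id)
-- The lower constant 1 comes from the edgeless graph, the upper constant 16 from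
-- `throttlingProduct≤`; both hold from order 1 on.
corollary4p12 = extremal , M , M-max , 1ℚ , fromℕ 16 , 1 ,
  from-yes (0ℚ ℚ.<? 1ℚ) , from-yes (0ℚ ℚ.<? fromℕ 16) , s≤s z≤n , bounds
  where
  extremal : ∀ r → 1 ≤ r → ∃[ n ] Σ[ G ∈ Graph n ] ∃[ p ]
    n ≡ 7 * r × HasThrottlingProduct G p × p ≡ 24 * r × fromℕ p ≡ + (24 * n) / 7
  extremal (suc r) _ = _ , copies r , 24 * suc r , *-comm (suc r) 7 , throttlingProduct-copies r , refl ,
    trans (24r≡24n/7 (suc r)) (cong (λ n → + (24 * n) / 7) (*-comm 7 (suc r)))

  M : ℕ → ℕ
  -- No graph has order 0, so a default value stands in for the maximum.
  M zero        = zero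
  M n@(suc n-1) = proj₁ (maxThrottlingProduct n _)

  M-max : ∀ n → 1 ≤ n → IsMaxThrottlingProduct n (M n)
  M-max n@(suc n-1) _ = proj₂ (maxThrottlingProduct n _)

  bounds : ∀ n → 1 ≤ n → 1ℚ ℚ.* fromℕ n ℚ.≤ fromℕ (M n) × fromℕ (M n) ℚ.≤ fromℕ 16 ℚ.* fromℕ n
  bounds n 1≤n with (G , prod) , maximal ← M-max n 1≤n =
    subst (ℚ._≤ fromℕ (M n)) (sym (ℚ.*-identityˡ (fromℕ n))) (fromℕ-mono-≤
      (≤-trans (n≤throttlingProduct-edgeless n n≢0) (maximal (edgeless n n≢0 , throttlingProduct-correct _)))) ,
    subst (fromℕ (M n) ℚ.≤_) (fromℕ-homo-* 16 n) (fromℕ-mono-≤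
      (subst (_≤ 16 * n) (sym (throttlingProduct-unique G prod)) (throttlingProduct≤ G)))
    where n≢0 = ℕ.>-nonZero 1≤n
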